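{- Let $d_1<d_2<\cdots$ be the elements of $D$ and $u_1<u_2<\cdots$ the elements of $U$ in increasing order. Then \[\{d_{k+2}-d_k:k\ge1\}=\{u_{k+2}-u_k:k\ge1\}=\{2,3,4,5,6,8,10\}.\]
   Context: $\phi=(1+\sqrt5)/2$. For positive integers $a_1,a_2$, the $(a_1,a_2)$-Fibonacci walk is $w_k=w_k(a_1,a_2)$ with $w_1=a_1$, $w_2=a_2$, $w_{k+2}=w_{k+1}+w_k$. Let $s(n;a_1,a_2)$ be the integer $s$ with $w_s(a_1,a_2)=n$ ($-\infty$ if none), and $s(n)=\max_{a_1,a_2\ge1}s(n;a_1,a_2)$. A pair $(a_1,a_2)$ is $n$-good if $a_1,a_2\ge1$ and $s(n;a_1,a_2)=s(n)$; its walk is then an $n$-slow Fibonacci walk. An integer $n\ge2$ is in $D$ (down-integer) if $w_{s(n)+1}=\lfloor\phi n\rfloor$ for some $n$-slow walk, and in $U$ (up-integer) if $w_{s(n)+1}=\lceil\phi n\rceil$ for some $n$-slow walk. -}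

module Defs where

open import Data.Nat using (ℕ; zero; suc; _+_; _*_; _∸_; _≤_; _<_)
open import Data.Product using (Σ; ∃; _×_; _,_)
open import Data.List using (List; _∷_; [])
open import Data.List.Membership.Propositional using (_∈_)
open import Relation.Binary.PropositionalEquality using (_≡_)

-- The (a₁,a₂)-Fibonacci walk, indexed from 1: walk a₁ a₂ 1 = a₁, walk a₁ a₂ 2 = a₂.
-- (Index 0 is a dummy value and is never used: all indices below are required ≥ 1.)
walk : ℕ → ℕ → ℕ → ℕ
walk a₁ a₂ zero = 0
walk a₁ a₂ (suc zero) = a₁
walk a₁ a₂ (suc (suc zero)) = a₂
walk a₁ a₂ (suc (suc (suc k))) = walk a₁ a₂ (suc (suc k)) + walk a₁ a₂ (suc k)

IsS : ℕ → ℕ → Set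
IsS n S =
  (∃ λ a₁ → ∃ λ a₂ → 1 ≤ a₁ × 1 ≤ a₂ × 1 ≤ S × walk a₁ a₂ S ≡ n)
  × (∀ a₁ a₂ k → 1 ≤ a₁ → 1 ≤ a₂ → 1 ≤ k → walk a₁ a₂ k ≡ n → k ≤ S)

-- m = ⌊φ n⌋.  For natural m, n: m ≤ φ n  ⇔  m*m ≤ m*n + n*n.
IsFloorPhi : ℕ → ℕ → Set
IsFloorPhi n m = (m * m ≤ m * n + n * n) × (suc m * n + n * n < suc m * suc m)

-- m = ⌈φ n⌉ : the least natural m with φ n ≤ m, i.e. m*n + n*n ≤ m*m.
IsCeilPhi : ℕ → ℕ → Set
IsCeilPhi n m = (m * n + n * n ≤ m * m) × (∀ k → k < m → k * k < k * n + n * n)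

SlowNext : (ℕ → ℕ → Set) → ℕ → Set
SlowNext Q n = ∃ λ S → IsS n S × (∃ λ a₁ → ∃ λ a₂ →
  1 ≤ a₁ × 1 ≤ a₂ × walk a₁ a₂ S ≡ n × Q n (walk a₁ a₂ (suc S)))

InD : ℕ → Set
InD n = 2 ≤ n × SlowNext IsFloorPhi n

InU : ℕ → Set
InU n = 2 ≤ n × SlowNext IsCeilPhi n

IsEnum : (ℕ → Set) → (ℕ → ℕ) → Set
IsEnum P d = (∀ i → d i < d (suc i)) × (∀ n → (P n → ∃ λ k → d k ≡ n) × ((∃ λ k → d k ≡ n) → P n))

GapSet : (ℕ → ℕ) → List ℕ → Set
GapSet d L = ∀ m → ((∃ λ k → d (suc (suc k)) ∸ d k ≡ m) → m ∈ L) × (m ∈ L → ∃ λ k → d (suc (suc k)) ∸ d k ≡ m)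

targetGaps : List ℕ
targetGaps = 2 ∷ 3 ∷ 4 ∷ 5 ∷ 6 ∷ 8 ∷ 10 ∷ []

{-# OPTIONS --safe #-}
-- Every n ≥ 2 is F k · a + F (k+1) · b for a unique k and some 1 ≤ b ≤ a ≤ F (k+1); then s(n) = k + 2, and n is in
-- U or in D according to the parity of k.  For n ≥ 16 this describes U as the set of n for which some integer m lies in
-- a thin strip above the line m = φ n, and D likewise below that line.  All boundary lines of the strips have slopes
-- between 8/5 and 5/3, so each boundary is respected by the steps (1,1), (1,2), (2,3), (3,5), (5,8) in the obvious
-- direction, and the vertical width of the strips exceeds 2φ - 3.  Hence consecutive elements differ by 1, 2, 3 or 5,
-- and a difference 5 is never adjacent to a difference 2, which excludes 7 = 2 + 5.
module Submission where

open import Defs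
open import Data.Bool using (Bool; true; false; not; if_then_else_)
open import Data.Bool.Properties using (not-involutive) renaming (_≟_ to _≟ᵇ_)
open import Data.Empty using (⊥; ⊥-elim)
open import Data.List.Membership.Propositional using (_∈_)
open import Data.List.Relation.Unary.All as All using (All; []; _∷_)
open import Data.List.Relation.Unary.Any using (here; there)
open import Data.Nat using (ℕ; zero; suc; z≤n; s≤s)
open import Data.Product using (Σ; ∃; _×_; _,_; proj₁; proj₂)
open import Data.Sum as Sum using (_⊎_; inj₁; inj₂; swap)
open import Relation.Nullary using (¬_; Dec; yes; no; does; contradiction)
open import Relation.Nullary.Decidable using (True; toWitness; ¬?; _×-dec_; _⊎-dec_; _→-dec_)
open import Relation.Binary.PropositionalEquality

-- The inequalities 1 ≤ b ≤ a ≤ F (k + 1) change with k, so the region of pairs (n , m) behind U or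
-- D is not cut out by two parallel lines: it is a union, over k of one parity, of pieces whose
-- edges have different rational slopes. Its two boundaries are therefore separated into predicates
-- that each choose their own k, and a boundary is used only through the directions in which a point
-- keeps satisfying it. The price is that the two choices of k must be reconciled afterwards, by
-- extending the walk backwards until b ≤ a. The number φ itself never occurs: pairs are tested by
-- integer linear forms, the terms of the walk continued backwards from (n , m). All this needs k ≥
-- 4, while k ≤ 3 gives at most 2 · 3 + 3 · 3 = 15; hence the threshold 16, below which everything
-- is evaluated. A difference 4 is impossible because n and n + 4 force n + 2 or n + 3.

module SlowWalks where
  open import Data.Nat hiding (_≟_)
  open import Data.Nat.Properties
  open import Data.Nat.Coprimality as Coprime using (Coprime; coprime-divisor; coprime-+)
  open import Data.Nat.Divisibility using (_∣_; ∣⇒≤; ∣m+n∣m⇒∣n; m∣m*n)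
  open import Data.Nat.Tactic.RingSolver using (solve-∀)

  -- Fibonacci numbers, Cassini's identity and shifts of walks.

  fib : ℕ → ℕ
  fib zero = 0
  fib (suc zero) = 1
  fib (suc (suc k)) = fib (suc k) + fib k

  fib-pos : ∀ k → 1 ≤ fib (suc k)
  fib-pos zero = ≤-refl
  fib-pos (suc k) = ≤-trans (fib-pos k) (m≤m+n _ _)

  fib-mono : ∀ k → fib k ≤ fib (suc k)
  fib-mono zero = z≤n
  fib-mono (suc k) = m≤m+n _ _

  fib-coprime : ∀ k → Coprime (fib (suc k)) (fib k)
  fib-coprime zero = Coprime.1-coprimeTo 0
  fib-coprime (suc k) = coprime-+ (Coprime.sym (fib-coprime k))

  even? : ℕ → Bool
  even? zero = true
  even? (suc k) = not (even? k)

  -- The two parities feed each other in one induction, since F (k+1)² - F k F (k+2) changes sign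
  -- with k; over ℕ the excess 1 goes to the smaller product.
  cassini-even : ∀ k → even? k ≡ true → fib (1 + k) * fib (1 + k) ≡ suc (fib k * fib (2 + k))
  cassini-odd : ∀ k → even? k ≡ false → fib k * fib (2 + k) ≡ suc (fib (1 + k) * fib (1 + k))
  cassini-even zero _ = refl
  cassini-even (suc k) e with even? k in eq
  ... | false = begin
    (y + x) * (y + x)             ≡⟨ lem₁ x y ⟩
    x * (y + x) + (y * y + x * y) ≡⟨ cong (_+ (y * y + x * y)) (cassini-odd k eq) ⟩
    suc (y * y) + (y * y + x * y) ≡⟨ cong suc (lem₂ x y) ⟩
    suc (y * (y + x + y))         ∎
    where
    open ≡-Reasoning
    x = fib k
    y = fib (suc k)
    lem₁ : ∀ x y → (y + x) * (y + x) ≡ x * (y + x) + (y * y + x * y)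
    lem₁ = solve-∀
    lem₂ : ∀ x y → y * y + (y * y + x * y) ≡ y * (y + x + y)
    lem₂ = solve-∀
  cassini-odd (suc k) e with even? k in eq
  ... | true = begin
    y * (y + x + y)               ≡⟨ lem₁ x y ⟩
    y * y + (y * y + x * y)       ≡⟨ cong (_+ (y * y + x * y)) (cassini-even k eq) ⟩
    suc (x * (y + x)) + (y * y + x * y) ≡⟨ cong suc (lem₂ x y) ⟩
    suc ((y + x) * (y + x))       ∎
    where
    open ≡-Reasoning
    x = fib k
    y = fib (suc k)
    lem₁ : ∀ x y → y * (y + x + y) ≡ y * y + (y * y + x * y)
    lem₁ = solve-∀
    lem₂ : ∀ x y → x * (y + x) + (y * y + x * y) ≡ (y + x) * (y + x)
    lem₂ = solve-∀

  walk-fib : ∀ a b k → walk a b (2 + k) ≡ fib k * a + fib (1 + k) * b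
  walk-fib a b zero = sym (+-identityʳ b)
  walk-fib a b (suc zero) = lem a b
    where
    lem : ∀ a b → b + a ≡ 1 * a + 1 * b
    lem = solve-∀
  walk-fib a b (suc (suc k)) =
    trans (cong₂ _+_ (walk-fib a b (suc k)) (walk-fib a b k)) (lem a b (fib k) (fib (suc k)))
    where
    lem : ∀ a b x y → y * a + (y + x) * b + (x * a + y * b) ≡ (y + x) * a + (y + x + y) * b
    lem = solve-∀

  walk-tail : ∀ a b k → walk a b (2 + k) ≡ walk b (b + a) (1 + k)
  walk-tail a b zero = refl
  walk-tail a b (suc zero) = refl
  walk-tail a b (suc (suc k)) = cong₂ _+_ (walk-tail a b (suc k)) (walk-tail a b k)

  -- With it, excluding one index for all positive starts excludes every later index too: a longer
  -- walk is cut at its front.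
  walk-drop : ∀ a b j k → 1 ≤ a → 1 ≤ b →
    ∃ λ c → ∃ λ d → 1 ≤ c × 1 ≤ d × walk a b (j + (2 + k)) ≡ walk c d (2 + k)
  walk-drop a b zero k 1≤a 1≤b = a , b , 1≤a , 1≤b , refl
  walk-drop a b (suc j) k 1≤a 1≤b
    with c , d , 1≤c , 1≤d , eq ← walk-drop b (b + a) j k 1≤b (≤-trans 1≤b (m≤m+n b a))
    = c , d , 1≤c , 1≤d , trans (lem j) eq
    where
    lem : ∀ j → walk a b (suc j + (2 + k)) ≡ walk b (b + a) (j + (2 + k))
    lem j rewrite +-suc j (suc k) = walk-tail a b (j + suc k)

  -- Position of a pair relative to the line y = φ x.

  Below Above : ℕ → ℕ → Set
  Below x y = y * y < y * x + x * x
  Above x y = y * x + x * x < y * y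

  Side : Bool → ℕ → ℕ → Set
  Side true = Above
  Side false = Below

  private
    next-square : ∀ x y → y * x + x * x + (y * y + x * y) ≡ (y + x) * (y + x)
    next-square = solve-∀

    next-product : ∀ x y → y * y + (y * y + x * y) ≡ (y + x) * y + y * y
    next-product = solve-∀

  -- The form y² - x y - x² becomes its negative under (x , y) ↦ (y , y + x). Subtraction is avoided
  -- by adding y² + x y to both sides.
  side-step : ∀ β {x y} → Side β x y → Side (not β) y (y + x)
  side-step true {x} {y} h = subst₂ _<_ (next-square x y) (next-product x y) (+-monoˡ-< (y * y + x * y) h)
  side-step false {x} {y} h = subst₂ _<_ (next-product x y) (next-square x y) (+-monoˡ-< (y * y + x * y) h)

  ≤⇒Below : ∀ {x y} → 1 ≤ x → y ≤ x → Below x y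
  ≤⇒Below {x} {y} 1≤x y≤x = ≤-<-trans (*-monoʳ-≤ y y≤x) (m<m+n (y * x) (*-mono-≤ 1≤x 1≤x))

  walk-side : ∀ a b k → 1 ≤ a → b ≤ a → Side (even? k) (walk a b (2 + k)) (walk a b (3 + k))
  walk-side a b zero 1≤a b≤a = side-step false {a} {b} (≤⇒Below 1≤a b≤a)
  walk-side a b (suc k) 1≤a b≤a = side-step (even? k) (walk-side a b k 1≤a b≤a)

  fib-side : ∀ k → Side (not (even? k)) (fib (1 + k)) (fib (2 + k))
  fib-side zero = s≤s (s≤s z≤n)
  fib-side (suc k) = side-step (not (even? k)) (fib-side k)

  -- With y = x + e and p = q + f the goal is (x + e) e < x² and the hypothesis on p / q is (q + f)
  -- f < q². As e / x ≤ f / q, multiplying the goal by q² reduces it to the hypothesis.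
  Below-slope : ∀ {p q x y} → 1 ≤ x → 1 ≤ q → Below q p → q * y ≤ p * x → Below x y
  Below-slope {p} {q} {x} {y} 1≤x 1≤q h le with ≤-total y x
  ... | inj₁ y≤x = ≤⇒Below 1≤x y≤x
  ... | inj₂ x≤y with e , refl ← m≤n⇒∃[o]m+o≡n x≤y
    with f , refl ← m≤n⇒∃[o]m+o≡n (*-cancelʳ-≤ q p x {{>-nonZero 1≤x}} (≤-trans (*-monoʳ-≤ q x≤y) le))
    = subst (_< (x + e) * x + x * x) (sym (*-distribˡ-+ (x + e) x e))
        (+-monoʳ-< ((x + e) * x) (*-cancelˡ-< (q * q) _ _ main))
    where
    qe≤fx : q * e ≤ f * x
    qe≤fx = +-cancelˡ-≤ (q * x) _ _ (subst₂ _≤_ (*-distribˡ-+ q x e) (*-distribʳ-+ x q f) le)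
    pf<qq : (q + f) * f < q * q
    pf<qq = +-cancelˡ-< ((q + f) * q) _ _ (subst (_< (q + f) * q + q * q) (*-distribˡ-+ (q + f) q f) h)
    lem₁ : ∀ q x e → q * q * ((x + e) * e) ≡ q * (x + e) * (q * e)
    lem₁ = solve-∀
    lem₂ : ∀ q f x → (q + f) * x * (f * x) ≡ (q + f) * f * (x * x)
    lem₂ = solve-∀
    open ≤-Reasoning
    main : q * q * ((x + e) * e) < q * q * (x * x)
    main = begin-strict
      q * q * ((x + e) * e)       ≡⟨ lem₁ q x e ⟩
      q * (x + e) * (q * e)       ≤⟨ *-mono-≤ le qe≤fx ⟩
      (q + f) * x * (f * x)       ≡⟨ lem₂ q f x ⟩
      (q + f) * f * (x * x)       <⟨ *-monoˡ-< (x * x) {{>-nonZero (*-mono-≤ 1≤x 1≤x)}} pf<qq ⟩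
      q * q * (x * x)             ∎

  Above⇒≤ : ∀ {x y} → Above x y → x ≤ y
  Above⇒≤ {x} {y} h with ≤-total x y
  ... | inj₁ x≤y = x≤y
  ... | inj₂ y≤x = contradiction (<-≤-trans (≤-<-trans (m≤m+n (y * x) (x * x)) h) (*-monoʳ-≤ y y≤x)) (<-irrefl refl)

  Above-slope : ∀ {p q x y} → 1 ≤ x → 1 ≤ q → Above q p → p * x ≤ q * y → Above x y
  Above-slope {p} {q} {x} {y} 1≤x 1≤q h le
    with f , refl ← m≤n⇒∃[o]m+o≡n (Above⇒≤ {q} {p} h)
    with e , refl ← m≤n⇒∃[o]m+o≡n (*-cancelˡ-≤ {x} {y} q {{>-nonZero 1≤q}} (≤-trans (*-monoˡ-≤ x (m≤m+n q f)) le))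
    = subst ((x + e) * x + x * x <_) (sym (*-distribˡ-+ (x + e) x e))
        (+-monoʳ-< ((x + e) * x) (*-cancelˡ-< (q * q) _ _ main))
    where
    fx≤qe : f * x ≤ q * e
    fx≤qe = +-cancelˡ-≤ (q * x) _ _ (subst₂ _≤_ (*-distribʳ-+ x q f) (*-distribˡ-+ q x e) le)
    qq<pf : q * q < (q + f) * f
    qq<pf = +-cancelˡ-< ((q + f) * q) _ _ (subst ((q + f) * q + q * q <_) (*-distribˡ-+ (q + f) q f) h)
    lem₁ : ∀ q x e → q * (x + e) * (q * e) ≡ q * q * ((x + e) * e)
    lem₁ = solve-∀
    lem₂ : ∀ q f x → (q + f) * f * (x * x) ≡ (q + f) * x * (f * x)
    lem₂ = solve-∀
    open ≤-Reasoning
    main : q * q * (x * x) < q * q * ((x + e) * e)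
    main = begin-strict
      q * q * (x * x)             <⟨ *-monoˡ-< (x * x) {{>-nonZero (*-mono-≤ 1≤x 1≤x)}} qq<pf ⟩
      (q + f) * f * (x * x)       ≡⟨ lem₂ q f x ⟩
      (q + f) * x * (f * x)       ≤⟨ *-mono-≤ le fx≤qe ⟩
      q * (x + e) * (q * e)       ≡⟨ lem₁ q x e ⟩
      q * q * ((x + e) * e)       ∎

  -- The normal form of n and the value s(n).

  record Rep (n k : ℕ) : Set where
    constructor rep
    field
      a b : ℕ
      1≤b : 1 ≤ b
      b≤a : b ≤ a
      a≤F : a ≤ fib (1 + k)
      value : fib k * a + fib (1 + k) * b ≡ n

    1≤a : 1 ≤ a
    1≤a = ≤-trans 1≤b b≤a

    walk≡n : walk a b (2 + k) ≡ n
    walk≡n = trans (walk-fib a b k) value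

    next : ℕ
    next = walk a b (3 + k)

  walk-fib-tail : ∀ c d k → walk c d (3 + k) ≡ fib k * d + fib (1 + k) * (d + c)
  walk-fib-tail c d k = trans (walk-tail c d (1 + k)) (walk-fib d (d + c) k)

  -- Both walks give n = F k · _ + F (1 + k) · _, so F (1 + k) divides a - d by coprimality, while 0 < a - d < F (1 + k).
  Rep-maximal : ∀ {n k c d} → Rep n k → 1 ≤ c → 1 ≤ d → walk c d (3 + k) ≢ n
  Rep-maximal {n} {k} {c} {d} r 1≤c 1≤d eq = cases
    where
    open Rep r
    x = fib k
    y = fib (1 + k)
    same : x * a + y * b ≡ x * d + y * (d + c)
    same = trans value (trans (sym eq) (walk-fib-tail c d k))
    too-large : a ≤ d → ⊥
    too-large a≤d = <-irrefl same (+-mono-≤-< (*-monoʳ-≤ x a≤d)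
      (*-monoʳ-< y {{>-nonZero (fib-pos k)}} (≤-<-trans (≤-trans b≤a a≤d) (m<m+n d 1≤c))))
    same-difference : ∀ e → d + e ≡ a → x * e + y * b ≡ y * (d + c)
    same-difference e refl = +-cancelˡ-≡ (x * d) _ _ (trans (lem x y d e b) same)
      where
      lem : ∀ x y d e b → x * d + (x * e + y * b) ≡ x * (d + e) + y * b
      lem = solve-∀
    y∣e : ∀ e → d + e ≡ a → y ∣ e
    y∣e e p = coprime-divisor (fib-coprime k)
      (∣m+n∣m⇒∣n (subst (y ∣_) (trans (sym (same-difference e p)) (+-comm (x * e) (y * b))) (m∣m*n (d + c))) (m∣m*n b))
    divides-small : ∀ e → d + e ≡ a → ⊥
    divides-small zero p = too-large (≤-reflexive (trans (sym p) (+-identityʳ d)))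
    divides-small (suc e) p = <-irrefl refl (<-≤-trans
      (subst (suc e <_) p (m<n+m (suc e) 1≤d)) (≤-trans a≤F (∣⇒≤ (y∣e (suc e) p))))
    cases : ⊥
    cases with ≤-total a d
    ... | inj₁ a≤d = too-large a≤d
    ... | inj₂ d≤a with e , p ← m≤n⇒∃[o]m+o≡n d≤a = divides-small e p

  Rep⇒IsS : ∀ {n k} → Rep n k → IsS n (2 + k)
  Rep⇒IsS {n} {k} r = (a , b , 1≤a , 1≤b , s≤s z≤n , walk≡n) , bound
    where
    open Rep r
    bound : ∀ c d t → 1 ≤ c → 1 ≤ d → 1 ≤ t → walk c d t ≡ n → t ≤ 2 + k
    bound c d t 1≤c 1≤d _ eq with t ≤? 2 + k
    ... | yes p = p
    ... | no ¬p with j , refl ← m≤n⇒∃[o]m+o≡n (≰⇒> ¬p)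
      with c′ , d′ , 1≤c′ , 1≤d′ , eq′ ← walk-drop c d j (suc k) 1≤c 1≤d
      = ⊥-elim (Rep-maximal r 1≤c′ 1≤d′ (trans (sym eq′) (trans (cong (walk c d) (+-comm j (3 + k))) eq)))

  IsS-unique : ∀ {n S T} → IsS n S → IsS n T → S ≡ T
  IsS-unique ((a , b , 1≤a , 1≤b , 1≤S , eq) , maxS) ((c , d , 1≤c , 1≤d , 1≤T , eq′) , maxT) =
    ≤-antisym (maxT _ _ _ 1≤a 1≤b 1≤S eq) (maxS _ _ _ 1≤c 1≤d 1≤T eq′)

  module _ {n k : ℕ} (r : Rep n k) where
    open Rep r

    private
      m-fib : next ≡ fib (1 + k) * a + fib (2 + k) * b
      m-fib = walk-fib a b (1 + k)

    Rep-side : Side (even? k) n next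
    Rep-side = subst (λ t → Side (even? k) t next) walk≡n (walk-side a b k 1≤a b≤a)

    -- By Cassini, `a` is the error between F (2+k) n and F (1+k) `next`. Hence a ≤ F (1+k) keeps
    -- `next` within 1 of n F (2+k) / F (1+k), a convergent on the opposite side of φ; this yields
    -- the ceiling or the floor.
    next-even : even? k ≡ true → fib (2 + k) * n + a ≡ fib (1 + k) * next
    next-even e = begin
      fib (2 + k) * n + a              ≡⟨ cong (λ t → fib (2 + k) * t + a) value ⟨
      z * (x * a + y * b) + a          ≡⟨ lem₁ x y z a b ⟩
      suc (x * z) * a + y * (z * b)    ≡⟨ cong (λ t → t * a + y * (z * b)) (cassini-even k e) ⟨
      y * y * a + y * (z * b)          ≡⟨ lem₂ y z a b ⟩
      y * (y * a + z * b)              ≡⟨ cong (y *_) m-fib ⟨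
      y * next                         ∎
      where
      open ≡-Reasoning
      x = fib k
      y = fib (1 + k)
      z = fib (2 + k)
      lem₁ : ∀ x y z a b → z * (x * a + y * b) + a ≡ suc (x * z) * a + y * (z * b)
      lem₁ = solve-∀
      lem₂ : ∀ y z a b → y * y * a + y * (z * b) ≡ y * (y * a + z * b)
      lem₂ = solve-∀

    next-odd : even? k ≡ false → fib (2 + k) * n ≡ fib (1 + k) * next + a
    next-odd e = begin
      fib (2 + k) * n                  ≡⟨ cong (fib (2 + k) *_) value ⟨
      z * (x * a + y * b)              ≡⟨ lem₁ x y z a b ⟩
      x * z * a + y * (z * b)          ≡⟨ cong (λ t → t * a + y * (z * b)) (cassini-odd k e) ⟩
      suc (y * y) * a + y * (z * b)    ≡⟨ lem₂ y z a b ⟩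
      y * (y * a + z * b) + a          ≡⟨ cong (λ t → y * t + a) m-fib ⟨
      y * next + a                     ∎
      where
      open ≡-Reasoning
      x = fib k
      y = fib (1 + k)
      z = fib (2 + k)
      lem₁ : ∀ x y z a b → z * (x * a + y * b) ≡ x * z * a + y * (z * b)
      lem₁ = solve-∀
      lem₂ : ∀ y z a b → suc (y * y) * a + y * (z * b) ≡ y * (y * a + z * b) + a
      lem₂ = solve-∀

    n-pos : 1 ≤ n
    n-pos = subst (1 ≤_) value (≤-trans (*-mono-≤ (fib-pos k) 1≤b) (m≤n+m _ (fib k * a)))

    Rep⇒ceil : even? k ≡ true → IsCeilPhi n next
    Rep⇒ceil e = <⇒≤ (subst (λ β → Side β n next) e Rep-side) , below
      where
      below : ∀ j → j < next → Below n j
      below j j<m = Below-slope {fib (2 + k)} n-pos (fib-pos k)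
        (subst (λ β → Side (not β) (fib (1 + k)) (fib (2 + k))) e (fib-side k))
        (+-cancelʳ-≤ (fib (1 + k)) _ _ (begin
          fib (1 + k) * j + fib (1 + k)   ≡⟨ +-comm _ (fib (1 + k)) ⟩
          fib (1 + k) + fib (1 + k) * j   ≡⟨ *-suc (fib (1 + k)) j ⟨
          fib (1 + k) * suc j             ≤⟨ *-monoʳ-≤ (fib (1 + k)) j<m ⟩
          fib (1 + k) * next              ≡⟨ next-even e ⟨
          fib (2 + k) * n + a             ≤⟨ +-monoʳ-≤ (fib (2 + k) * n) a≤F ⟩
          fib (2 + k) * n + fib (1 + k)   ∎))
        where open ≤-Reasoning

    Rep⇒floor : even? k ≡ false → IsFloorPhi n next
    Rep⇒floor e = <⇒≤ (subst (λ β → Side β n next) e Rep-side) ,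
      Above-slope {fib (2 + k)} n-pos (fib-pos k)
        (subst (λ β → Side (not β) (fib (1 + k)) (fib (2 + k))) e (fib-side k))
        (begin
          fib (2 + k) * n                    ≡⟨ next-odd e ⟩
          fib (1 + k) * next + a             ≤⟨ +-monoʳ-≤ (fib (1 + k) * next) a≤F ⟩
          fib (1 + k) * next + fib (1 + k)   ≡⟨ +-comm _ (fib (1 + k)) ⟩
          fib (1 + k) + fib (1 + k) * next   ≡⟨ *-suc (fib (1 + k)) next ⟨
          fib (1 + k) * suc next             ∎)
      where open ≤-Reasoning

    slow-next : ∀ {Q} → Q n next → SlowNext Q n
    slow-next q = 2 + k , Rep⇒IsS r , a , b , 1≤a , 1≤b , walk≡n , q

    -- A slow walk need not be the normalised one, but it has d ≤ c, as otherwise (d - c , c) would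
    -- start a longer walk to n. Its side of φ n is then fixed by the parity of k, which makes U and
    -- D disjoint.
    slow-side : ∀ {Q} → SlowNext Q n → ∃ λ m → Q n m × Side (even? k) n m
    slow-side (S , isS , c , d , 1≤c , 1≤d , eq , q) with refl ← IsS-unique isS (Rep⇒IsS r)
      = walk c d (3 + k) , q , subst (λ t → Side (even? k) t (walk c d (3 + k))) eq (walk-side c d k 1≤c d≤c)
      where
      d≤c : d ≤ c
      d≤c with d ≤? c
      ... | yes p = p
      ... | no ¬p with e , refl ← m≤n⇒∃[o]m+o≡n (≰⇒> ¬p) = ⊥-elim (Rep-maximal r (s≤s (z≤n {e})) 1≤c
        (trans (walk-tail (suc e) c (suc k)) (trans (cong (λ t → walk c t (2 + k)) (+-suc c e)) eq)))

  -- Existence of the normal form; membership in U and D is decidable.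

  Class : Bool → ℕ → Set
  Class true = InU
  Class false = InD

  Rep⇒Class : ∀ {n k} → 2 ≤ n → Rep n k → Class (even? k) n
  Rep⇒Class {n} {k} 2≤n r with even? k in e
  ... | true = 2≤n , slow-next r {IsCeilPhi} (Rep⇒ceil r e)
  ... | false = 2≤n , slow-next r {IsFloorPhi} (Rep⇒floor r e)

  Class⇒even? : ∀ β {n k} → Rep n k → Class β n → even? k ≡ β
  Class⇒even? true {n} {k} r (_ , sn) with m , (above , _) , s ← slow-side r {IsCeilPhi} sn with even? k
  ... | true = refl
  ... | false = contradiction s (≤⇒≯ above)
  Class⇒even? false {n} {k} r (_ , sn) with m , (below , _) , s ← slow-side r {IsFloorPhi} sn with even? k
  ... | false = refl
  ... | true = contradiction s (≤⇒≯ below)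

  -- Replacing (a , b) by (a - F (1 + k) , b + F k) keeps the value.
  reduce : ∀ fuel k a b → a ≤ fuel → 1 ≤ a → 1 ≤ b → ∃ λ c → ∃ λ d →
    1 ≤ c × 1 ≤ d × c ≤ fib (1 + k) × c + d ≤ a + b × fib k * c + fib (1 + k) * d ≡ fib k * a + fib (1 + k) * b
  reduce zero k a b a≤0 1≤a 1≤b = contradiction (≤-trans 1≤a a≤0) λ ()
  reduce (suc fuel) k a b a≤ 1≤a 1≤b with a ≤? fib (1 + k)
  ... | yes p = a , b , 1≤a , 1≤b , p , ≤-refl , refl
  ... | no ¬p
    with c , d , 1≤c , 1≤d , c≤ , s≤ , eq ← reduce fuel k (a ∸ fib (1 + k)) (b + fib k)
           (≤-trans (∸-monoʳ-≤ a (fib-pos k)) (∸-monoˡ-≤ 1 a≤)) (m<n⇒0<n∸m (≰⇒> ¬p)) (≤-trans 1≤b (m≤m+n _ _))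
    = c , d , 1≤c , 1≤d , c≤ , ≤-trans s≤ sum≤ , trans eq same
    where
    y = fib (1 + k)
    split : a ∸ y + y ≡ a
    split = m∸n+n≡m (≰⇒≥ ¬p)
    -- The sum does not grow because F k ≤ F (1+k); `find` uses it as its measure.
    sum≤ : a ∸ y + (b + fib k) ≤ a + b
    sum≤ = begin
      a ∸ y + (b + fib k) ≤⟨ +-monoʳ-≤ (a ∸ y) (+-monoʳ-≤ b (fib-mono k)) ⟩
      a ∸ y + (b + y)     ≡⟨ lem (a ∸ y) b y ⟩
      a ∸ y + y + b       ≡⟨ cong (_+ b) split ⟩
      a + b               ∎
      where
      open ≤-Reasoning
      lem : ∀ u b y → u + (b + y) ≡ u + y + b
      lem = solve-∀
    same : fib k * (a ∸ y) + y * (b + fib k) ≡ fib k * a + y * b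
    same = trans (lem (fib k) (a ∸ y) y b) (cong (λ t → fib k * t + y * b) split)
      where
      lem : ∀ x u y b → x * u + y * (b + x) ≡ x * (u + y) + y * b
      lem = solve-∀

  -- While b > a the walk is extended backwards, which replaces (a , b) by (b - a , a) one level up.
  find : ∀ fuel k a b → a + b ≤ fuel → 1 ≤ a → 1 ≤ b → ∃ (Rep (fib k * a + fib (1 + k) * b))
  find zero k a b ab≤ 1≤a 1≤b = contradiction (≤-trans 1≤a (≤-trans (m≤m+n a b) ab≤)) λ ()
  find (suc fuel) k a b ab≤ 1≤a 1≤b with c , d , 1≤c , 1≤d , c≤ , s≤ , eq ← reduce a k a b ≤-refl 1≤a 1≤b
    with d ≤? c
  ... | yes d≤c = k , rep c d 1≤d d≤c c≤ eq
  ... | no d≰c = let l , r = find fuel (suc k) (d ∸ c) c (≤-pred (≤-trans smaller (≤-trans s≤ ab≤))) (m<n⇒0<n∸m (≰⇒> d≰c)) 1≤c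
                 in l , subst (λ n → Rep n l) same r
    where
    split : d ∸ c + c ≡ d
    split = m∸n+n≡m (≰⇒≥ d≰c)
    smaller : suc (d ∸ c + c) ≤ c + d
    smaller = ≤-trans (s≤s (≤-reflexive split)) (m<n+m d 1≤c)
    lem : ∀ x y u c → y * u + (y + x) * c ≡ x * c + y * (u + c)
    lem = solve-∀
    same : fib (1 + k) * (d ∸ c) + fib (2 + k) * c ≡ fib k * a + fib (1 + k) * b
    same = trans (lem (fib k) (fib (1 + k)) (d ∸ c) c)
      (trans (cong (λ t → fib k * c + fib (1 + k) * t) split) eq)

  Rep-exists : ∀ n → 2 ≤ n → ∃ (Rep n)
  -- The start is the walk 1, n + 1, n + 2, that is, the pair (1 , n + 1) at level 1.
  Rep-exists (suc (suc n)) _ = let k , r = find (2 + n) 1 1 (1 + n) ≤-refl ≤-refl (s≤s z≤n)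
                               in k , subst (λ t → Rep t k) (lem n) r
    where
    lem : ∀ n → 1 * 1 + 1 * (1 + n) ≡ 2 + n
    lem = solve-∀
  Rep-exists (suc zero) (s≤s ())

  Class? : ∀ β n → Dec (Class β n)
  Class? β n with 2 ≤? n
  ... | no ¬p = no (λ c → ¬p (two β c))
    where
    two : ∀ β → Class β n → 2 ≤ n
    two true = proj₁
    two false = proj₁
  ... | yes p with k , r ← Rep-exists n p with even? k ≟ᵇ β
  ...   | yes eq = yes (subst (λ β → Class β n) eq (Rep⇒Class p r))
  ...   | no neq = no (λ c → neq (Class⇒even? β r c))

open SlowWalks

module Strips where
  import Data.Nat as ℕ
  import Data.Nat.Properties as ℕ
  open import Data.Integer using (ℤ; +_; -[1+_]; 0ℤ; 1ℤ; -1ℤ; _+_; _-_; _*_; -_; _≤_; +≤+; -≤+)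
  open import Data.Integer.Properties
  open import Data.Integer.Tactic.RingSolver using (solve-∀)

  -- Integer inequalities and the walk read backwards.

  infixl 6 _⊕_
  infixl 7 _⊗_

  _⊕_ : ∀ {x y} → 0ℤ ≤ x → 0ℤ ≤ y → 0ℤ ≤ x + y
  _⊕_ = +-mono-≤

  _⊗_ : ∀ {x y} → 0ℤ ≤ x → 0ℤ ≤ y → 0ℤ ≤ x * y
  _⊗_ {+ x} {+ y} _ _ = subst (0ℤ ≤_) (pos-* x y) (+≤+ z≤n)
  _⊗_ { -[1+ _ ]} ()
  _⊗_ {+ _} { -[1+ _ ]} _ ()

  gap≥0 : ∀ {x y} → x ≤ y → 0ℤ ≤ y - x
  gap≥0 = i≤j⇒0≤j-i

  ≤-by : ∀ {x y z} → 0ℤ ≤ z → z ≡ y - x → x ≤ y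
  ≤-by h eq = 0≤i-j⇒j≤i (subst (0ℤ ≤_) eq h)

  nat≥0 : ∀ n → 0ℤ ≤ + n
  nat≥0 n = +≤+ z≤n

  ≤⊎> : ∀ x y → x ≤ y ⊎ y + 1ℤ ≤ x
  ≤⊎> x y with x ≤? y
  ... | yes p = inj₁ p
  ... | no ¬p = inj₂ (subst (_≤ x) (+-comm 1ℤ y) (i<j⇒suc[i]≤j (≰⇒> ¬p)))

  -- The walk with n , m as adjacent terms, read backwards: n , m - n , 2n - m , …
  back : ℕ → ℤ → ℤ → ℤ
  back zero n m = n
  back (suc k) n m = back k (m - n) n

  back-rec : ∀ k n m → back (2 ℕ.+ k) n m ≡ back k n m - back (1 ℕ.+ k) n m
  back-rec zero n m = refl
  back-rec (suc k) n m = back-rec k (m - n) n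

  back-rec₃ : ∀ k n m → back (3 ℕ.+ k) n m ≡ + 2 * back (1 ℕ.+ k) n m - back k n m
  back-rec₃ k n m = trans (back-rec (1 ℕ.+ k) n m) (trans (cong (_-_ (back (1 ℕ.+ k) n m)) (back-rec k n m)) (lem (back k n m) (back (1 ℕ.+ k) n m)))
    where
    lem : ∀ b a → a - (b - a) ≡ + 2 * a - b
    lem = solve-∀

  back-rec₄ : ∀ k n m → back (4 ℕ.+ k) n m ≡ + 2 * back k n m - + 3 * back (1 ℕ.+ k) n m
  back-rec₄ k n m = trans (back-rec (2 ℕ.+ k) n m) (trans (cong₂ _-_ (back-rec k n m) (back-rec₃ k n m)) (lem (back k n m) (back (1 ℕ.+ k) n m)))
    where
    lem : ∀ b a → b - a - (+ 2 * a - b) ≡ + 2 * b - + 3 * a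
    lem = solve-∀

  back-+ : ∀ k n m i j → back k (n + i) (m + j) ≡ back k n m + back k i j
  back-+ zero n m i j = refl
  back-+ (suc k) n m i j = trans (cong (λ t → back k t (n + i)) (lem n m i j)) (back-+ k (m - n) n (j - i) i)
    where
    lem : ∀ n m i j → m + j - (n + i) ≡ m - n + (j - i)
    lem = solve-∀

  back-inverse : ∀ k n m →
    n ≡ + fib k * back (1 ℕ.+ k) n m + + fib (1 ℕ.+ k) * back k n m ×
    m ≡ + fib (1 ℕ.+ k) * back (1 ℕ.+ k) n m + + fib (2 ℕ.+ k) * back k n m
  back-inverse zero n m = lem₁ n m , lem₂ n m
    where
    lem₁ : ∀ n m → n ≡ + 0 * (m - n) + + 1 * n
    lem₁ = solve-∀
    lem₂ : ∀ n m → m ≡ + 1 * (m - n) + + 1 * n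
    lem₂ = solve-∀
  back-inverse (suc k) n m with p , q ← back-inverse k (m - n) n =
    q , trans (lem₁ n m) (trans (cong₂ _+_ p q)
          (lem₂ (+ fib k) (+ fib (1 ℕ.+ k)) (back (2 ℕ.+ k) n m) (back (1 ℕ.+ k) n m)))
    where
    lem₁ : ∀ n m → m ≡ (m - n) + n
    lem₁ = solve-∀
    lem₂ : ∀ x y a b → x * a + y * b + (y * a + (y + x) * b) ≡ (y + x) * a + (y + x + y) * b
    lem₂ = solve-∀

  back-walk : ∀ k a b →
    back k (+ walk a b (2 ℕ.+ k)) (+ walk a b (3 ℕ.+ k)) ≡ + b ×
    back (1 ℕ.+ k) (+ walk a b (2 ℕ.+ k)) (+ walk a b (3 ℕ.+ k)) ≡ + a
  back-walk zero a b = refl , lem (+ a) (+ b)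
    where
    lem : ∀ a b → b + a - b ≡ a
    lem = solve-∀
  back-walk (suc k) a b with p , q ← back-walk k a b =
    trans (cong (λ t → back k t v) (lem u v)) p , trans (cong (λ t → back (1 ℕ.+ k) t v) (lem u v)) q
    where
    u = + walk a b (2 ℕ.+ k)
    v = + walk a b (3 ℕ.+ k)
    lem : ∀ u v → v + u - v ≡ u
    lem = solve-∀

  -- The form `j * 2` makes `level s (suc j)` compute to `2 + level s j`, of the same parity.
  level : ℕ → ℕ → ℕ
  level s j = 3 ℕ.+ (j ℕ.* 2 ℕ.+ s)

  -- Two levels on, the pair (b , a) becomes (b - a , 2 a - b), so opposite signs persist and b
  -- never moves back towards 0. Two sign conditions at one level thus control all higher levels.
  alternating-≤ : ∀ {s n m t} → t ≤ 0ℤ → ∀ i j → back (level s i) n m ≤ t → 0ℤ ≤ back (1 ℕ.+ level s i) n m →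
    back (level s (j ℕ.+ i)) n m ≤ t × 0ℤ ≤ back (1 ℕ.+ level s (j ℕ.+ i)) n m
  alternating-≤ t≤0 i zero p q = p , q
  alternating-≤ {s} {n} {m} {t} t≤0 i (suc j) p q
    with p′ , q′ ← alternating-≤ {s} {n} {m} t≤0 i j p q
    = ≤-by (gap≥0 p′ ⊕ q′) (trans (lem₁ t (back k n m) (back (1 ℕ.+ k) n m)) (cong (_-_ t) (sym (back-rec k n m))))
    , subst (0ℤ ≤_) (trans (lem₂ t (back k n m) (back (1 ℕ.+ k) n m)) (sym (back-rec₃ k n m))) (gap≥0 p′ ⊕ q′ ⊕ (q′ ⊕ gap≥0 t≤0))
    where
    k = level s (j ℕ.+ i)
    lem₁ : ∀ t b a → t - b + a ≡ t - (b - a)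
    lem₁ = solve-∀
    lem₂ : ∀ t b a → t - b + a + (a + (0ℤ - t)) ≡ + 2 * a - b
    lem₂ = solve-∀

  alternating-≥ : ∀ {s n m t} → 0ℤ ≤ t → ∀ i j → t ≤ back (level s i) n m → back (1 ℕ.+ level s i) n m ≤ 0ℤ →
    t ≤ back (level s (j ℕ.+ i)) n m × back (1 ℕ.+ level s (j ℕ.+ i)) n m ≤ 0ℤ
  alternating-≥ 0≤t i zero p q = p , q
  alternating-≥ {s} {n} {m} {t} 0≤t i (suc j) p q
    with p′ , q′ ← alternating-≥ {s} {n} {m} 0≤t i j p q
    = ≤-by (gap≥0 p′ ⊕ gap≥0 q′) (trans (lem₁ t (back k n m) (back (1 ℕ.+ k) n m)) (cong (_- t) (sym (back-rec k n m))))
    , ≤-by (gap≥0 p′ ⊕ gap≥0 q′ ⊕ (gap≥0 q′ ⊕ 0≤t)) (trans (lem₂ t (back k n m) (back (1 ℕ.+ k) n m)) (cong (_-_ 0ℤ) (sym (back-rec₃ k n m))))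
    where
    k = level s (j ℕ.+ i)
    lem₁ : ∀ t b a → b - t + (0ℤ - a) ≡ b - a - t
    lem₁ = solve-∀
    lem₂ : ∀ t b a → b - t + (0ℤ - a) + ((0ℤ - a) + t) ≡ 0ℤ - (+ 2 * a - b)
    lem₂ = solve-∀

  -- Neg says that m lies on the correct side of φ n (the terms of one parity eventually turn negative);
  -- Win bounds its distance from φ n.  Levels start at 3 + s with s = 1 for U and s = 2 for D, because
  -- from there on all convergents of φ involved lie between 8/5 and 5/3.
  Neg Win : ℕ → ℤ → ℤ → Set
  Neg s n m = ∃ λ j → back (level s j) n m ≤ -1ℤ
  Win s n m = ∃ λ j → 1ℤ ≤ back (level s j) n m × back (1 ℕ.+ level s j) n m ≤ + fib (1 ℕ.+ level s j)

  Down Up : ℕ → ℤ → ℤ → Set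
  Down s i j = back (3 ℕ.+ s) i j ≤ 0ℤ × 0ℤ ≤ back (4 ℕ.+ s) i j
  Up s i j = 0ℤ ≤ back (3 ℕ.+ s) i j × back (4 ℕ.+ s) i j ≤ 0ℤ

  Neg-Down : ∀ s n m i j → Neg s n m → Down s i j → Neg s (n + i) (m + j)
  Neg-Down s n m i j (t , p) (d , e) = t , subst (_≤ -1ℤ) (sym (back-+ (level s t) n m i j))
    (+-mono-≤ p (subst (λ u → back (level s u) i j ≤ 0ℤ) (ℕ.+-identityʳ t)
      (proj₁ (alternating-≤ {s} {i} {j} ≤-refl 0 t d e))))

  Win-Up : ∀ s n m i j → Win s n m → Up s i j → Win s (n + i) (m + j)
  Win-Up s n m i j (t , p , q) (d , e) = t ,
    subst (1ℤ ≤_) (sym (back-+ (level s t) n m i j)) (+-mono-≤ p d′) ,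
    subst₂ _≤_ (sym (back-+ (1 ℕ.+ level s t) n m i j)) (+-identityʳ _) (+-mono-≤ q e′)
    where
    alt : 0ℤ ≤ back (level s t) i j × back (1 ℕ.+ level s t) i j ≤ 0ℤ
    alt = subst (λ u → 0ℤ ≤ back (level s u) i j × back (1 ℕ.+ level s u) i j ≤ 0ℤ) (ℕ.+-identityʳ t)
      (alternating-≥ {s} {i} {j} ≤-refl 0 t d e)
    d′ = proj₁ alt
    e′ = proj₂ alt

  -- Difference arguments in a strip with lower boundary `A` and upper boundary `B`.

  module Strip (A B : ℤ → ℤ → Set) where

    -- back 4, 5, 6 of (i , j) are 5i - 3j, 5j - 8i, 13i - 8j; so Plus vectors point above all lines of slope 8/5 to 5/3.
    Plus Minus : ℤ → ℤ → Set
    Plus i j = back 4 i j ≤ 0ℤ × 0ℤ ≤ back 5 i j × back 6 i j ≤ 0ℤ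
    Minus i j = 0ℤ ≤ back 4 i j × back 5 i j ≤ 0ℤ × 0ℤ ≤ back 6 i j

    plus? : ∀ i j → Dec (Plus i j)
    plus? i j = (_ ≤? _) ×-dec (_ ≤? _) ×-dec (_ ≤? _)

    minus? : ∀ i j → Dec (Minus i j)
    minus? i j = (_ ≤? _) ×-dec (_ ≤? _) ×-dec (_ ≤? _)

    S : ℤ → Set
    S n = ∃ λ m → A n m × B n m

    module Steps
      (A-closed : ∀ n m i j → A n m → Plus i j → A (n + i) (m + j))
      (B-closed : ∀ n m i j → B n m → Minus i j → B (n + i) (m + j))
      where

      A⁺ : ∀ {n m} i j → A n m → {_ : True (plus? i j)} → A (n + i) (m + j)
      A⁺ {n} {m} i j a {p} = A-closed n m i j a (toWitness p)

      B⁺ : ∀ {n m} i j → B n m → {_ : True (minus? i j)} → B (n + i) (m + j)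
      B⁺ {n} {m} i j b {p} = B-closed n m i j b (toWitness p)

      shift : ∀ n i i′ → n + i + (i′ - i) ≡ n + i′
      shift = solve-∀

      moveA : ∀ n m i j i′ j′ → A (n + i) (m + j) → {_ : True (plus? (i′ - i) (j′ - j))} → A (n + i′) (m + j′)
      moveA n m i j i′ j′ a {p} = subst₂ A (shift n i i′) (shift m j j′) (A-closed (n + i) (m + j) (i′ - i) (j′ - j) a (toWitness p))

      moveB : ∀ n m i j i′ j′ → B (n + i) (m + j) → {_ : True (minus? (i′ - i) (j′ - j))} → B (n + i′) (m + j′)
      moveB n m i j i′ j′ b {p} = subst₂ B (shift n i i′) (shift m j j′) (B-closed (n + i) (m + j) (i′ - i) (j′ - j) b (toWitness p))

      raiseA : ∀ {n m} t → A n m → A n (m + + t)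
      raiseA {n} {m} zero a = subst (A n) (sym (+-identityʳ m)) a
      raiseA {n} {m} (suc t) a = subst₂ A (+-identityʳ n) (lem m (+ t)) (A⁺ 0ℤ 1ℤ (raiseA t a))
        where
        lem : ∀ m t → m + t + 1ℤ ≡ m + (1ℤ + t)
        lem = solve-∀

      lowerB : ∀ {n m} t → B n (m + + t) → B n m
      lowerB {n} {m} zero b = subst (B n) (+-identityʳ m) b
      lowerB {n} {m} (suc t) b = lowerB t (subst₂ B (+-identityʳ n) (lem m (+ t)) (B⁺ 0ℤ -1ℤ b))
        where
        lem : ∀ m t → m + (1ℤ + t) + -1ℤ ≡ m + t
        lem = solve-∀

      private
        difference : ∀ {x y} → x ≤ y → ∃ λ t → y ≡ x + + t
        difference {x} {y} x≤y with y - x in eq | gap≥0 x≤y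
        ... | + t | _ = t , trans (lem x y) (cong (_+_ x) eq)
          where
          lem : ∀ x y → y ≡ x + (y - x)
          lem = solve-∀

      A-mono : ∀ {n x y} → x ≤ y → A n x → A n y
      A-mono x≤y a with t , refl ← difference x≤y = raiseA t a

      B-anti : ∀ {n x y} → x ≤ y → B n y → B n x
      B-anti x≤y b with t , refl ← difference x≤y = lowerB t b

      -- The height y of the element n + i is unknown. Cutting at m + j tells which boundary can be
      -- moved vertically from y to the cut.
      side : ∀ {n m} i j → S (n + i) → A (n + i) (m + j) ⊎ B (n + i) (m + (j + 1ℤ))
      side {n} {m} i j (y , a , b) with ≤⊎> y (m + j)
      ... | inj₁ p = inj₁ (A-mono p a)
      ... | inj₂ p = inj₂ (B-anti (subst (_≤ y) (+-assoc m j 1ℤ) p) b)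

      S₁ : ∀ {n m} → A n m → B (n + + 1) (m + + 2) → S (n + + 1)
      S₁ {n} {m} a b = m + + 2 , A⁺ (+ 1) (+ 2) a , b

      S₂ : ∀ {n m} → B n m → A (n + + 2) (m + + 3) → S (n + + 2)
      S₂ {n} {m} b a = m + + 3 , a , B⁺ (+ 2) (+ 3) b

      S₃ : ∀ {n m} → A n m → B (n + + 3) (m + + 5) → S (n + + 3)
      S₃ {n} {m} a b = m + + 5 , A⁺ (+ 3) (+ 5) a , b

      S₅ : ∀ {n m} → B n m → A (n + + 5) (m + + 8) → S (n + + 5)
      S₅ {n} {m} b a = m + + 8 , a , B⁺ (+ 5) (+ 8) b

      -- Here and in `step₄`, `step₇`, the second element supplies one boundary at a new lattice
      -- point and (n , m) supplies the other. In this case height at most m + 3 leads to n + 5, and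
      -- height at least m + 4 to n + 1.
      step₂ : ∀ {n} → S n → S (n + + 2) → S (n + + 1) ⊎ S (n + + 5)
      step₂ {n} (m , a , b) s with side {n} {m} (+ 2) (+ 3) s
      ... | inj₁ a′ = inj₂ (S₅ b (moveA n m (+ 2) (+ 3) (+ 5) (+ 8) a′))
      ... | inj₂ b′ = inj₁ (S₁ a (moveB n m (+ 2) (+ 4) (+ 1) (+ 2) b′))

      step₄ : ∀ {n} → S n → S (n + + 4) → S (n + + 2) ⊎ S (n + + 3)
      step₄ {n} (m , a , b) s with side {n} {m} (+ 4) (+ 6) s
      ... | inj₁ a′ = inj₁ (S₂ b (moveA n m (+ 4) (+ 6) (+ 2) (+ 3) a′))
      ... | inj₂ b′ = inj₂ (S₃ a (moveB n m (+ 4) (+ 7) (+ 3) (+ 5) b′))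

      step₇ : ∀ {n} → S n → S (n + + 7) → S (n + + 2) ⊎ S (n + + 3)
      step₇ {n} (m , a , b) s with side {n} {m} (+ 7) (+ 11) s
      ... | inj₁ a′ = inj₁ (S₂ b (moveA n m (+ 7) (+ 11) (+ 2) (+ 3) a′))
      ... | inj₂ b′ = inj₂ (S₃ a (moveB n m (+ 7) (+ 12) (+ 3) (+ 5) b′))

      step₃₅ : ∀ {n} → (∀ m → B (n + + 3) (m + + 5) ⊎ A (n + + 5) (m + + 8)) → S n → S (n + + 3) ⊎ S (n + + 5)
      step₃₅ wide (m , a , b) with wide m
      ... | inj₁ b′ = inj₁ (S₃ a b′)
      ... | inj₂ a′ = inj₂ (S₅ b a′)

  -- The width of the strips.

  scale : ℕ → ℕ → ℕ
  scale s j = fib (level s j) ℕ.* fib (2 ℕ.+ (j ℕ.* 2 ℕ.+ s))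

  scale-< : ∀ s j → scale s j ℕ.< scale s (1 ℕ.+ j)
  scale-< s j = ℕ.*-mono-< (fib-< (2 ℕ.+ K)) (fib-< (1 ℕ.+ K))
    where
    K = j ℕ.* 2 ℕ.+ s
    fib-< : ∀ k → fib (1 ℕ.+ k) ℕ.< fib (3 ℕ.+ k)
    fib-< k = ℕ.m<n+m (fib (1 ℕ.+ k)) (fib-pos (1 ℕ.+ k))

  -- `scale s j` is F k F (k - 1) for k = `level s j`; the bracket selects the level at which the
  -- width is tested.
  scale-bracket : ∀ s n → scale s 0 ℕ.≤ n → ∃ λ j → scale s j ℕ.≤ n × n ℕ.< scale s (1 ℕ.+ j)
  scale-bracket s n lo with d , refl ← ℕ.m≤n⇒∃[o]m+o≡n lo = go d
    where
    go : ∀ d → ∃ λ j → scale s j ℕ.≤ scale s 0 ℕ.+ d × scale s 0 ℕ.+ d ℕ.< scale s (1 ℕ.+ j)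
    go zero = 0 , ℕ.m≤m+n _ 0 , subst (ℕ._< scale s 1) (sym (ℕ.+-identityʳ _)) (scale-< s 0)
    go (suc d) with j , p , q ← go d with scale s 0 ℕ.+ suc d ℕ.<? scale s (1 ℕ.+ j)
    ... | yes r = j , ℕ.≤-trans p (ℕ.+-monoʳ-≤ (scale s 0) (ℕ.n≤1+n d)) , r
    ... | no ¬r = suc j , ℕ.≮⇒≥ ¬r , ℕ.≤-<-trans (subst (ℕ._≤ scale s (1 ℕ.+ j)) (sym (ℕ.+-suc (scale s 0) d)) q) (scale-< s (1 ℕ.+ j))

  back-fib : ∀ s i j → back (3 ℕ.+ s) i j ≡ + fib s → back (4 ℕ.+ s) i j ≡ - + fib (1 ℕ.+ s) →
    ∀ t → back (level s t) i j ≡ + fib (t ℕ.* 2 ℕ.+ s) × back (1 ℕ.+ level s t) i j ≡ - + fib (1 ℕ.+ (t ℕ.* 2 ℕ.+ s))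
  back-fib s i j p q zero = p , q
  back-fib s i j p q (suc t) with p′ , q′ ← back-fib s i j p q t =
    trans (back-rec k i j) (trans (cong₂ _-_ p′ q′) (lem₁ (+ fib K) (+ fib (1 ℕ.+ K)))) ,
    trans (back-rec₃ k i j) (trans (cong₂ (λ a b → + 2 * a - b) q′ p′) (lem₂ (+ fib K) (+ fib (1 ℕ.+ K))))
    where
    k = level s t
    K = t ℕ.* 2 ℕ.+ s
    lem₁ : ∀ x y → x - - y ≡ y + x
    lem₁ = solve-∀
    lem₂ : ∀ x y → + 2 * - y - x ≡ - (y + x + y)
    lem₂ = solve-∀

  -- Refutation by certificate: nonnegative terms are combined with `⊕` and `⊗`, and the ring solver
  -- identifies the result with a negative constant.
  absurd : ∀ {x} n → 0ℤ ≤ x → x ≡ -[1+ n ] → ⊥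
  absurd n () refl

  module _ (s : ℕ) (1≤s : 1 ℕ.≤ s) (i j : ℤ)
           (ci : back (3 ℕ.+ s) i j ≡ + fib s) (cj : back (4 ℕ.+ s) i j ≡ - + fib (1 ℕ.+ s)) where

    -- The strip is wider than ∣ 2 φ - 3 ∣: (i , j) will be ± (2 , 3).
    Win⊎Neg : ∀ n m → scale s 0 ℕ.≤ n → Win s (+ n) m ⊎ Neg s (+ n + i) (m + j)
    Win⊎Neg n m lo with t , p , q ← scale-bracket s n lo = main
      where
      K = t ℕ.* 2 ℕ.+ s
      k = level s t
      x = + fib K
      y = + fib (1 ℕ.+ K)
      b = back k (+ n) m
      a = back (1 ℕ.+ k) (+ n) m
      Fk = y + x + y
      F₁ = y + x + y + (y + x)
      F₂ = F₁ + Fk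

      x-pos : 1ℤ ≤ x
      x-pos = +≤+ (pos t)
        where
        fib-pos′ : ∀ {k} → 1 ℕ.≤ k → 1 ℕ.≤ fib k
        fib-pos′ {suc k} _ = fib-pos k
        pos : ∀ t → 1 ℕ.≤ fib (t ℕ.* 2 ℕ.+ s)
        pos t = fib-pos′ (ℕ.≤-trans 1≤s (ℕ.m≤n+m s (t ℕ.* 2)))

      y≥0 : 0ℤ ≤ y
      y≥0 = nat≥0 _

      n≡ : + n ≡ Fk * a + F₁ * b
      n≡ = proj₁ (back-inverse k (+ n) m)

      n≥ : Fk * (y + x) ≤ Fk * a + F₁ * b
      n≥ = subst₂ _≤_ (pos-* (fib k) (fib (2 ℕ.+ K))) n≡ (+≤+ p)

      n< : Fk * a + F₁ * b + 1ℤ ≤ F₂ * F₁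
      n< = subst₂ _≤_ (trans (+-comm 1ℤ (+ n)) (cong (_+ 1ℤ) n≡)) (pos-* (fib (2 ℕ.+ k)) (fib (1 ℕ.+ k))) (+≤+ q)

      c₄ : back (4 ℕ.+ k) (+ n + i) (m + j) ≡ + 2 * (b + x) - + 3 * (a + - y)
      c₄ = trans (back-rec₄ k (+ n + i) (m + j)) (cong₂ (λ u v → + 2 * u - + 3 * v)
        (trans (back-+ k (+ n) m i j) (cong (_+_ b) (proj₁ (back-fib s i j ci cj t))))
        (trans (back-+ (1 ℕ.+ k) (+ n) m i j) (cong (_+_ a) (proj₂ (back-fib s i j ci cj t)))))

      neg : + 2 * (b + x) - + 3 * (a + - y) ≤ -1ℤ → Neg s (+ n + i) (m + j)
      -- Level t + 1 would give b + x - (a - y), which is 0 at b = 0, a = x + y; level t + 2 is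
      -- strict.
      neg h = 2 ℕ.+ t , subst (_≤ -1ℤ) (sym c₄) h

      -- Otherwise n ≤ Fk (x + y - 1), under the lower end of the bracket.
      a-large : b ≤ 0ℤ → y + x ≤ a
      a-large b≤0 with ≤⊎> (y + x) a
      ... | inj₁ h = h
      ... | inj₂ h = ⊥-elim (absurd 0
            (gap≥0 n≥ ⊕ (y≥0 ⊕ gap≥0 x-pos ⊕ y≥0 ⊕ nat≥0 1) ⊗ gap≥0 h
              ⊕ (y≥0 ⊕ nat≥0 _ ⊕ y≥0 ⊕ (y≥0 ⊕ nat≥0 _)) ⊗ gap≥0 b≤0 ⊕ (y≥0 ⊕ gap≥0 x-pos ⊕ y≥0))
            (lem x y a b))
        where
        lem : ∀ x y a b →
          ((y + x + y) * a + (y + x + y + (y + x)) * b - (y + x + y) * (y + x))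
          + (y + (x - 1ℤ) + y + + 1) * (y + x - (a + 1ℤ))
          + (y + x + y + (y + x)) * (0ℤ - b) + (y + (x - 1ℤ) + y) ≡ -1ℤ
        lem = solve-∀

      neg₁ : b ≤ 0ℤ → Neg s (+ n + i) (m + j)
      neg₁ b≤0 = neg (≤-by (nat≥0 2 ⊗ gap≥0 b≤0 ⊕ nat≥0 3 ⊗ gap≥0 (a-large b≤0) ⊕ gap≥0 x-pos) (lem x y a b))
        where
        lem : ∀ x y a b → + 2 * (0ℤ - b) + + 3 * (a - (y + x)) + (x - 1ℤ) ≡ -1ℤ - (+ 2 * (b + x) - + 3 * (a + - y))
        lem = solve-∀

      -- Otherwise n ≥ F₂ F₁ + Fk, over the upper end of the bracket.
      b-small : F₁ + 1ℤ ≤ a → b + 1ℤ ≤ F₁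
      b-small a> with ≤⊎> F₁ b
      ... | inj₂ h = h
      ... | inj₁ h = ⊥-elim (absurd 0
            (gap≥0 n< ⊕ (y≥0 ⊕ nat≥0 _ ⊕ y≥0) ⊗ gap≥0 a>
              ⊕ (y≥0 ⊕ nat≥0 _ ⊕ y≥0 ⊕ (y≥0 ⊕ nat≥0 _)) ⊗ gap≥0 h ⊕ (y≥0 ⊕ nat≥0 _ ⊕ y≥0))
            (lem x y a b))
        where
        lem : ∀ x y a b →
          ((y + x + y + (y + x) + (y + x + y)) * (y + x + y + (y + x)) - ((y + x + y) * a + (y + x + y + (y + x)) * b + 1ℤ))
          + (y + x + y) * (a - (y + x + y + (y + x) + 1ℤ))
          + (y + x + y + (y + x)) * (b - (y + x + y + (y + x))) + (y + x + y) ≡ -1ℤ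
        lem = solve-∀

      neg₂ : F₁ + 1ℤ ≤ a → Neg s (+ n + i) (m + j)
      neg₂ a> = neg (≤-by (nat≥0 2 ⊗ gap≥0 (b-small a>) ⊕ nat≥0 3 ⊗ gap≥0 a> ⊕ nat≥0 4) (lem x y a b))
        where
        lem : ∀ x y a b →
          + 2 * (y + x + y + (y + x) - (b + 1ℤ)) + + 3 * (a - (y + x + y + (y + x) + 1ℤ)) + + 4
          ≡ -1ℤ - (+ 2 * (b + x) - + 3 * (a + - y))
        lem = solve-∀

      main : Win s (+ n) m ⊎ Neg s (+ n + i) (m + j)
      main with ≤⊎> b 0ℤ | ≤⊎> a F₁
      ... | inj₁ b≤0 | _ = inj₂ (neg₁ b≤0)
      ... | inj₂ b≥1 | inj₁ a≤ = inj₁ (t , b≥1 , a≤)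
      ... | inj₂ _ | inj₂ a> = inj₂ (neg₂ a>)

  -- Normal forms correspond to points of the strip.

  even?-level : ∀ s j → even? (level s j) ≡ even? (3 ℕ.+ s)
  even?-level s zero = refl
  even?-level s (suc j) = trans (not-involutive _) (even?-level s j)

  Rep⇒strip : ∀ {n} s j → Rep n (level s j) → ∃ λ m → Neg s (+ n) m × Win s (+ n) m
  Rep⇒strip {n} s j r = + next , (2 ℕ.+ j , neg) , (j , win₁ , win₂)
    where
    open Rep r
    k = level s j
    b≡ : back k (+ n) (+ next) ≡ + b
    b≡ = subst (λ t → back k (+ t) (+ next) ≡ + b) walk≡n (proj₁ (back-walk k a b))
    a≡ : back (1 ℕ.+ k) (+ n) (+ next) ≡ + a
    a≡ = subst (λ t → back (1 ℕ.+ k) (+ t) (+ next) ≡ + a) walk≡n (proj₂ (back-walk k a b))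
    win₁ : 1ℤ ≤ back k (+ n) (+ next)
    win₁ = subst (1ℤ ≤_) (sym b≡) (+≤+ 1≤b)
    win₂ : back (1 ℕ.+ k) (+ n) (+ next) ≤ + fib (1 ℕ.+ k)
    win₂ = subst (_≤ + fib (1 ℕ.+ k)) (sym a≡) (+≤+ a≤F)
    -- The term b - a at 2 + k may vanish, so the sign is read two terms further on, from 2 b - 3 a.
    neg : back (4 ℕ.+ k) (+ n) (+ next) ≤ -1ℤ
    neg = subst (_≤ -1ℤ) (sym (trans (back-rec₄ k (+ n) (+ next)) (cong₂ (λ u v → + 2 * u - + 3 * v) b≡ a≡)))
      (≤-by (nat≥0 2 ⊗ gap≥0 (+≤+ b≤a) ⊕ gap≥0 (+≤+ 1≤a)) (lem (+ a) (+ b)))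
      where
      lem : ∀ a b → + 2 * (a - b) + (a - 1ℤ) ≡ -1ℤ - (+ 2 * b - + 3 * a)
      lem = solve-∀

  module _ {s n : ℕ} {m : ℤ} (1≤n : 1 ℕ.≤ n) (j′ : ℕ) (neg : back (level s j′) (+ n) m ≤ -1ℤ) where

    private
      C : ℕ → ℤ
      C k = back k (+ n) m

    -- If a ≤ 0 < b at level j, alternation keeps b positive from j on, against the sign at j′ when
    -- j ≤ j′. When j′ ≤ j, a nonnegative a at j′ would carry the negative b up to j, and a negative
    -- a there would make n negative.
    a-positive : ∀ j → 1ℤ ≤ C (level s j) → 1ℤ ≤ C (1 ℕ.+ level s j)
    a-positive j b≥1 with ≤⊎> (C (1 ℕ.+ level s j)) 0ℤ
    ... | inj₂ p = p
    ... | inj₁ a≤0 with ℕ.≤-total j j′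
    ...   | inj₁ j≤j′
      = ⊥-elim (absurd 1 (gap≥0 neg ⊕ gap≥0 (subst (λ t → 1ℤ ≤ C (level s t)) (ℕ.m∸n+n≡m j≤j′)
          (proj₁ (alternating-≥ {s} {+ n} {m} (nat≥0 1) j (j′ ℕ.∸ j) b≥1 a≤0)))) (lem (C (level s j′))))
      where
      lem : ∀ x → -1ℤ - x + (x - 1ℤ) ≡ -[1+ 1 ]
      lem = solve-∀
    ...   | inj₂ j′≤j with ≤⊎> 0ℤ (C (1 ℕ.+ level s j′))
    ...     | inj₁ a′≥0
      = ⊥-elim (absurd 1 (gap≥0 (subst (λ t → C (level s t) ≤ -1ℤ) (ℕ.m∸n+n≡m j′≤j)
          (proj₁ (alternating-≤ {s} {+ n} {m} -≤+ j′ (j ℕ.∸ j′) neg a′≥0))) ⊕ gap≥0 b≥1) (lem (C (level s j))))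
      where
      lem : ∀ x → -1ℤ - x + (x - 1ℤ) ≡ -[1+ 1 ]
      lem = solve-∀
    ...     | inj₂ a′<0
      = ⊥-elim (absurd 0
          (gap≥0 (+≤+ 1≤n) ⊕ (nat≥0 (fib k) ⊗ (gap≥0 a′<0 ⊕ nat≥0 1) ⊕ nat≥0 (fib (1 ℕ.+ k)) ⊗ (gap≥0 neg ⊕ nat≥0 1)))
          (lem (+ n) (+ fib k) (+ fib (1 ℕ.+ k)) (C (1 ℕ.+ k)) (C k) (proj₁ (back-inverse k (+ n) m))))
      where
      k = level s j′
      lem₀ : ∀ x y a b → x * a + y * b - 1ℤ + (x * (0ℤ - (a + 1ℤ) + + 1) + y * (-1ℤ - b + + 1)) ≡ -1ℤ
      lem₀ = solve-∀
      lem : ∀ n x y a b → n ≡ x * a + y * b → n - 1ℤ + (x * (0ℤ - (a + 1ℤ) + + 1) + y * (-1ℤ - b + + 1)) ≡ -1ℤ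
      lem _ x y a b refl = lem₀ x y a b

    -- While a < b the walk extends two terms back, to (b - a , 2 a - b). As a ≥ 1, the first entry
    -- falls, so `fuel` bounds it, and 2 a - b < a preserves the upper bound. Once b ≤ a, all
    -- inequalities of `Rep` hold.
    descend : ∀ fuel j → C (level s j) ≤ + fuel → 1ℤ ≤ C (level s j) → C (1 ℕ.+ level s j) ≤ + fib (1 ℕ.+ level s j) →
      ∃ λ i → Rep n (level s i)
    descend zero j b≤ b≥1 _ = ⊥-elim (absurd 0 (gap≥0 b≤ ⊕ gap≥0 b≥1) (lem (C (level s j))))
      where
      lem : ∀ x → 0ℤ - x + (x - 1ℤ) ≡ -1ℤ
      lem = solve-∀
    descend (suc fuel) j b≤ b≥1 a≤ with ≤⊎> (C (level s j)) (C (1 ℕ.+ level s j))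
    ... | inj₁ b≤a = j , found _ _ refl refl b≥1 b≤a a≤
      where
      k = level s j
      found : ∀ x y → C (1 ℕ.+ k) ≡ x → C k ≡ y → 1ℤ ≤ C k → C k ≤ C (1 ℕ.+ k) → C (1 ℕ.+ k) ≤ + fib (1 ℕ.+ k) → Rep n k
      found (+ a) (+ b) eqa eqb b≥1 b≤a a≤ = rep a b
        (drop‿+≤+ (subst (1ℤ ≤_) eqb b≥1)) (drop‿+≤+ (subst₂ _≤_ eqb eqa b≤a)) (drop‿+≤+ (subst (_≤ + fib (1 ℕ.+ k)) eqa a≤))
        (+-injective (trans (cong₂ _+_ (pos-* (fib k) a) (pos-* (fib (1 ℕ.+ k)) b))
          (sym (trans (proj₁ (back-inverse k (+ n) m)) (cong₂ (λ u v → + fib k * u + + fib (1 ℕ.+ k) * v) eqa eqb)))))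
      found (+ a) -[1+ b ] eqa eqb b≥1 b≤a a≤ with () ← subst (1ℤ ≤_) eqb b≥1
      found -[1+ a ] y eqa eqb b≥1 b≤a a≤ with () ← subst (1ℤ ≤_) eqa (≤-trans b≥1 b≤a)
    ... | inj₂ a<b = descend fuel (suc j)
        (subst (_≤ + fuel) (sym (back-rec k (+ n) m)) (≤-by (gap≥0 b≤ ⊕ gap≥0 a≥1) (lem₁ (+ fuel) a b)))
        (subst (1ℤ ≤_) (sym (back-rec k (+ n) m)) (≤-by (gap≥0 a<b) (lem₂ a b)))
        (subst (_≤ + fib (3 ℕ.+ k)) (sym (back-rec₃ k (+ n) m))
          (≤-by (gap≥0 a≤ ⊕ gap≥0 a<b ⊕ nat≥0 1 ⊕ nat≥0 (fib (1 ℕ.+ k)) ⊕ nat≥0 (fib k)) (lem₃ (+ fib k) (+ fib (1 ℕ.+ k)) a b)))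
      where
      k = level s j
      a = C (1 ℕ.+ k)
      b = C k
      a≥1 : 1ℤ ≤ a
      a≥1 = a-positive j b≥1
      lem₁ : ∀ f a b → 1ℤ + f - b + (a - 1ℤ) ≡ f - (b - a)
      lem₁ = solve-∀
      lem₂ : ∀ a b → b - (a + 1ℤ) ≡ b - a - 1ℤ
      lem₂ = solve-∀
      lem₃ : ∀ x y a b → y - a + (b - (a + 1ℤ)) + + 1 + y + x ≡ y + x + y - (+ 2 * a - b)
      lem₃ = solve-∀

  strip⇒Rep : ∀ s n m → 1 ℕ.≤ n → Neg s (+ n) m → Win s (+ n) m → ∃ λ j → Rep n (level s j)
  strip⇒Rep s n m 1≤n (j′ , neg) (j , b≥1 , a≤) = go (back (level s j) (+ n) m) refl
    where
    go : ∀ x → back (level s j) (+ n) m ≡ x → ∃ λ j → Rep n (level s j)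
    go (+ x) eq = descend {s} {n} {m} 1≤n j′ neg x j (≤-reflexive eq) b≥1 a≤
    go -[1+ x ] eq with () ← subst (1ℤ ≤_) eq b≥1

  -- Local rules for U and D, valid at every n.

  record Steps (P : ℕ → Set) (n : ℕ) : Set where
    constructor steps
    field
      -- The alternatives `P (2 + n)` here and `P (4 + n)` in `skip₂` serve n = 4 in U: 6 and 8 are
      -- in U, but 5, 7 and 9 are in D.
      skip  : P n → P (2 ℕ.+ n) ⊎ P (3 ℕ.+ n) ⊎ P (5 ℕ.+ n)
      skip₂ : P n → P (2 ℕ.+ n) → P (1 ℕ.+ n) ⊎ P (4 ℕ.+ n) ⊎ P (5 ℕ.+ n)
      skip₄ : P n → P (4 ℕ.+ n) → P (2 ℕ.+ n) ⊎ P (3 ℕ.+ n)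
      skip₇ : P n → P (7 ℕ.+ n) → P (2 ℕ.+ n) ⊎ P (3 ℕ.+ n)

  Steps? : ∀ {P} → (∀ n → Dec (P n)) → ∀ n → Dec (Steps P n)
  Steps? {P} P? n with (P? n →-dec (P? (2 ℕ.+ n) ⊎-dec P? (3 ℕ.+ n) ⊎-dec P? (5 ℕ.+ n)))
    ×-dec (P? n →-dec (P? (2 ℕ.+ n) →-dec (P? (1 ℕ.+ n) ⊎-dec P? (4 ℕ.+ n) ⊎-dec P? (5 ℕ.+ n))))
    ×-dec (P? n →-dec (P? (4 ℕ.+ n) →-dec (P? (2 ℕ.+ n) ⊎-dec P? (3 ℕ.+ n))))
    ×-dec (P? n →-dec (P? (7 ℕ.+ n) →-dec (P? (2 ℕ.+ n) ⊎-dec P? (3 ℕ.+ n))))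
  ... | yes (p , q , r , s) = yes (steps p q r s)
  ... | no ¬p = no λ (steps p q r s) → ¬p (p , q , r , s)

  module _ {P : ℕ → Set} {A B : ℤ → ℤ → Set} where
    open Strip A B

    strip⇒Steps : (∀ n m i j → A n m → Plus i j → A (n + i) (m + j)) →
      (∀ n m i j → B n m → Minus i j → B (n + i) (m + j)) →
      (∀ n → 16 ℕ.≤ n → P n → S (+ n)) → (∀ n → 16 ℕ.≤ n → S (+ n) → P n) →
      (∀ n → 16 ℕ.≤ n → ∀ m → B (+ n + + 3) (m + + 5) ⊎ A (+ n + + 5) (m + + 8)) →
      ∀ n → 16 ℕ.≤ n → Steps P n
    strip⇒Steps A-closed B-closed P⇒S S⇒P wide n 16≤n = steps
      (λ p → inj₂ (Sum.map (from 3) (from 5) (step₃₅ (wide n 16≤n) (P⇒S n 16≤n p))))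
      (λ p q → Sum.map (from 1) (λ s → inj₂ (from 5 s)) (step₂ (P⇒S n 16≤n p) (to 2 q)))
      (λ p q → Sum.map (from 2) (from 3) (step₄ (P⇒S n 16≤n p) (to 4 q)))
      (λ p q → Sum.map (from 2) (from 3) (step₇ (P⇒S n 16≤n p) (to 7 q)))
      where
      open Strip.Steps A B A-closed B-closed
      bound : ∀ i → 16 ℕ.≤ i ℕ.+ n
      bound i = ℕ.≤-trans 16≤n (ℕ.m≤n+m n i)
      to : ∀ i → P (i ℕ.+ n) → S (+ n + + i)
      to i p = subst (λ t → S (+ t)) (ℕ.+-comm i n) (P⇒S (i ℕ.+ n) (bound i) p)
      from : ∀ i → S (+ n + + i) → P (i ℕ.+ n)
      from i s = S⇒P (i ℕ.+ n) (bound i) (subst (λ t → S (+ t)) (ℕ.+-comm n i) s)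

  fib-mono-≤ : ∀ {k l} → k ℕ.≤ l → fib k ℕ.≤ fib l
  fib-mono-≤ {k} k≤l with d , refl ← ℕ.m≤n⇒∃[o]m+o≡n k≤l = go d
    where
    go : ∀ d → fib k ℕ.≤ fib (k ℕ.+ d)
    go zero = ℕ.≤-reflexive (cong fib (sym (ℕ.+-identityʳ k)))
    go (suc d) = ℕ.≤-trans (go d) (subst (λ t → fib (k ℕ.+ d) ℕ.≤ fib t) (sym (ℕ.+-suc k d)) (fib-mono (k ℕ.+ d)))

  Rep-level-≥4 : ∀ {n k} → 16 ℕ.≤ n → Rep n k → ∃ λ K → k ≡ 4 ℕ.+ K
  Rep-level-≥4 {n} {k} 16≤n r with 4 ℕ.≤? k
  ... | yes p with K , eq ← ℕ.m≤n⇒∃[o]m+o≡n p = K , sym eq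
  ... | no ¬p = ⊥-elim (ℕ.<-irrefl refl (ℕ.≤-trans 16≤n n≤15))
    where
    open Rep r
    k≤3 : k ℕ.≤ 3
    k≤3 = ℕ.≤-pred (ℕ.≰⇒> ¬p)
    a≤3 : a ℕ.≤ 3
    a≤3 = ℕ.≤-trans a≤F (fib-mono-≤ (s≤s k≤3))
    n≤15 : n ℕ.≤ 15
    n≤15 = subst (ℕ._≤ 15) value
      (ℕ.+-mono-≤ (ℕ.*-mono-≤ (fib-mono-≤ k≤3) a≤3) (ℕ.*-mono-≤ (fib-mono-≤ (s≤s k≤3)) (ℕ.≤-trans b≤a a≤3)))

  which-level : ∀ K → (∃ λ j → 4 ℕ.+ K ≡ level 1 j × even? K ≡ true) ⊎ (∃ λ j → 4 ℕ.+ K ≡ level 2 j × even? K ≡ false)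
  which-level zero = inj₁ (0 , refl , refl)
  which-level (suc zero) = inj₂ (0 , refl , refl)
  which-level (suc (suc K)) = Sum.map next next (which-level K)
    where
    next : ∀ {s β} → (∃ λ j → 4 ℕ.+ K ≡ level s j × even? K ≡ β) → ∃ λ j → 6 ℕ.+ K ≡ level s j × not (not (even? K)) ≡ β
    next (j , eq , refl) = suc j , cong (2 ℕ.+_) eq , not-involutive (even? K)

  offset : Bool → ℕ
  offset true = 1
  offset false = 2

  Class⇒strip : ∀ β n → 16 ℕ.≤ n → Class β n → ∃ λ m → Neg (offset β) (+ n) m × Win (offset β) (+ n) m
  Class⇒strip β n 16≤n cl with k , r ← Rep-exists n (ℕ.≤-trans (s≤s (s≤s z≤n)) 16≤n)
    with eq ← Class⇒even? β r cl with K , refl ← Rep-level-≥4 16≤n r with which-level K | β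
  ... | inj₁ (j , k≡ , e) | true = Rep⇒strip 1 j (subst (Rep n) k≡ r)
  ... | inj₁ (j , k≡ , e) | false rewrite e with () ← eq
  ... | inj₂ (j , k≡ , e) | true rewrite e with () ← eq
  ... | inj₂ (j , k≡ , e) | false = Rep⇒strip 2 j (subst (Rep n) k≡ r)

  strip⇒Class : ∀ β n → 16 ℕ.≤ n → (∃ λ m → Neg (offset β) (+ n) m × Win (offset β) (+ n) m) → Class β n
  strip⇒Class β n 16≤n (m , neg , win) with j , r ← strip⇒Rep (offset β) n m (ℕ.≤-trans (s≤s z≤n) 16≤n) neg win
    = subst (λ β → Class β n) (trans (even?-level (offset β) j) (parity β)) (Rep⇒Class (ℕ.≤-trans (s≤s (s≤s z≤n)) 16≤n) r)
    where
    parity : ∀ β → even? (3 ℕ.+ offset β) ≡ β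
    parity true = refl
    parity false = refl

  U-Steps : ∀ n → 16 ℕ.≤ n → Steps InU n
  U-Steps = strip⇒Steps {InU} {Neg 1} {Win 1}
    (λ { n m i j a (p , q , _) → Neg-Down 1 n m i j a (p , q) })
    (λ { n m i j b (p , q , _) → Win-Up 1 n m i j b (p , q) })
    (Class⇒strip true) (strip⇒Class true) wide
    where
    wide : ∀ n → 16 ℕ.≤ n → ∀ m → Win 1 (+ n + + 3) (m + + 5) ⊎ Neg 1 (+ n + + 5) (m + + 8)
    wide n 16≤n m = subst₂ (λ x y → Win 1 (+ n + + 3) (m + + 5) ⊎ Neg 1 x y)
      (+-assoc (+ n) (+ 3) (+ 2)) (+-assoc m (+ 5) (+ 3))
      (Win⊎Neg 1 (s≤s z≤n) (+ 2) (+ 3) refl refl (n ℕ.+ 3) (m + + 5)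
        (ℕ.≤-trans (ℕ.≤-trans (ℕ.m≤m+n 6 10) 16≤n) (ℕ.m≤m+n n 3)))

  D-Steps : ∀ n → 16 ℕ.≤ n → Steps InD n
  D-Steps = strip⇒Steps {InD} {Win 2} {Neg 2}
    (λ { n m i j a (_ , p , q) → Win-Up 2 n m i j a (p , q) })
    (λ { n m i j b (_ , p , q) → Neg-Down 2 n m i j b (p , q) })
    (λ n h cl → let m , neg , win = Class⇒strip false n h cl in m , win , neg)
    (λ { n h (m , win , neg) → strip⇒Class false n h (m , neg , win) }) wide
    where
    wide : ∀ n → 16 ℕ.≤ n → ∀ m → Neg 2 (+ n + + 3) (m + + 5) ⊎ Win 2 (+ n + + 5) (m + + 8)
    -- For D the boundaries exchange roles, so the comparison runs from n + 5 back to n + 3 along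
    -- -(2 , 3). The 15 is `scale 2 0`, as the 6 for U is `scale 1 0`.
    wide n 16≤n m = swap (subst₂ (λ x y → Win 2 (+ n + + 5) (m + + 8) ⊎ Neg 2 x y)
      (+-assoc (+ n) (+ 5) -[1+ 1 ]) (+-assoc m (+ 8) -[1+ 2 ])
      (Win⊎Neg 2 (s≤s z≤n) -[1+ 1 ] -[1+ 2 ] refl refl (n ℕ.+ 5) (m + + 8)
        (ℕ.≤-trans (ℕ.≤-trans (ℕ.m≤m+n 15 1) 16≤n) (ℕ.m≤m+n n 5))))

  Class-Steps : ∀ β n → Steps (Class β) n
  Class-Steps β n with n ℕ.<? 16
  ... | yes n<16 = small β n<16
    where
    small : ∀ β {n} → n ℕ.< 16 → Steps (Class β) n
    -- `Class?` is run on closed numbers, at most 15 + 7 = 22.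
    small true = toWitness {a? = ℕ.allUpTo? (Steps? (Class? true)) 16} _
    small false = toWitness {a? = ℕ.allUpTo? (Steps? (Class? false)) 16} _
  ... | no n≮16 = large β
    where
    large : ∀ β → Steps (Class β) n
    large true = U-Steps n (ℕ.≮⇒≥ n≮16)
    large false = D-Steps n (ℕ.≮⇒≥ n≮16)

open Strips using (Steps; Class-Steps)

module Gaps where
  open import Data.Nat using (_+_; _∸_; _≤_; _<_)
  open import Data.Nat.Properties

  -- Gaps between consecutive elements.

  data Gap (P : ℕ → Set) (n : ℕ) : ℕ → Set where
    gap₁ : P (1 + n) → Gap P n 1
    gap₂ : ¬ P (1 + n) → P (2 + n) → Gap P n 2
    gap₃ : ¬ P (1 + n) → ¬ P (2 + n) → P (3 + n) → Gap P n 3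
    gap₅ : ¬ P (1 + n) → ¬ P (2 + n) → ¬ P (3 + n) → ¬ P (4 + n) → P (5 + n) → Gap P n 5

  module _ {P : ℕ → Set} where

    Gap-target : ∀ {n g} → Gap P n g → P (g + n)
    Gap-target (gap₁ p) = p
    Gap-target (gap₂ _ p) = p
    Gap-target (gap₃ _ _ p) = p
    Gap-target (gap₅ _ _ _ _ p) = p

    Gap-pos : ∀ {n g} → Gap P n g → 1 ≤ g
    Gap-pos (gap₁ _) = s≤s z≤n
    Gap-pos (gap₂ _ _) = s≤s z≤n
    Gap-pos (gap₃ _ _ _) = s≤s z≤n
    Gap-pos (gap₅ _ _ _ _ _) = s≤s z≤n

    Gap-empty : ∀ {n g} → Gap P n g → ∀ i → 1 ≤ i → i < g → ¬ P (i + n)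
    Gap-empty (gap₁ _) (suc i) _ (s≤s ())
    Gap-empty (gap₂ ¬1 _) 1 _ _ = ¬1
    Gap-empty (gap₂ ¬1 _) (suc (suc i)) _ (s≤s (s≤s ()))
    Gap-empty (gap₃ ¬1 _ _) 1 _ _ = ¬1
    Gap-empty (gap₃ _ ¬2 _) 2 _ _ = ¬2
    Gap-empty (gap₃ _ _ _) (suc (suc (suc i))) _ (s≤s (s≤s (s≤s ())))
    Gap-empty (gap₅ ¬1 _ _ _ _) 1 _ _ = ¬1
    Gap-empty (gap₅ _ ¬2 _ _ _) 2 _ _ = ¬2
    Gap-empty (gap₅ _ _ ¬3 _ _) 3 _ _ = ¬3
    Gap-empty (gap₅ _ _ _ ¬4 _) 4 _ _ = ¬4
    Gap-empty (gap₅ _ _ _ _ _) (suc (suc (suc (suc (suc i))))) _ (s≤s (s≤s (s≤s (s≤s (s≤s ())))))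

    -- Two summands from 1, 2, 3, 5 give the seven targets and 7, so only 2 + 5 and 5 + 2 need an
    -- argument.
    two-gaps : ∀ {n g h} → P n → Steps P n → Gap P n g → Gap P (g + n) h → h + g ∈ targetGaps
    two-gaps _ _ (gap₁ _) (gap₁ _) = here refl
    two-gaps _ _ (gap₁ _) (gap₂ _ _) = there (here refl)
    two-gaps _ _ (gap₁ _) (gap₃ _ _ _) = there (there (here refl))
    two-gaps _ _ (gap₁ _) (gap₅ _ _ _ _ _) = there (there (there (there (here refl))))
    two-gaps _ _ (gap₂ _ _) (gap₁ _) = there (here refl)
    two-gaps _ _ (gap₂ _ _) (gap₂ _ _) = there (there (here refl))
    two-gaps _ _ (gap₂ _ _) (gap₃ _ _ _) = there (there (there (here refl)))
    two-gaps p s (gap₂ ¬1 p₂) (gap₅ _ ¬4 ¬5 _ _) with Steps.skip₂ s p p₂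
    ... | inj₁ p₁ = contradiction p₁ ¬1
    ... | inj₂ (inj₁ p₄) = contradiction p₄ ¬4
    ... | inj₂ (inj₂ p₅) = contradiction p₅ ¬5
    two-gaps _ _ (gap₃ _ _ _) (gap₁ _) = there (there (here refl))
    two-gaps _ _ (gap₃ _ _ _) (gap₂ _ _) = there (there (there (here refl)))
    two-gaps _ _ (gap₃ _ _ _) (gap₃ _ _ _) = there (there (there (there (here refl))))
    two-gaps _ _ (gap₃ _ _ _) (gap₅ _ _ _ _ _) = there (there (there (there (there (here refl)))))
    two-gaps _ _ (gap₅ _ _ _ _ _) (gap₁ _) = there (there (there (there (here refl))))
    two-gaps p s (gap₅ _ ¬2 ¬3 _ _) (gap₂ _ p₇) with Steps.skip₇ s p p₇
    ... | inj₁ p₂ = contradiction p₂ ¬2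
    ... | inj₂ p₃ = contradiction p₃ ¬3
    two-gaps _ _ (gap₅ _ _ _ _ _) (gap₃ _ _ _) = there (there (there (there (there (here refl)))))
    two-gaps _ _ (gap₅ _ _ _ _ _) (gap₅ _ _ _ _ _) = there (there (there (there (there (there (here refl))))))

  -- Increasing enumeration and the differences that occur.

  module Enumeration (P : ℕ → Set) (P? : ∀ n → Dec (P n)) (Steps-P : ∀ n → Steps P n)
                     (first : ℕ) (P-first : P first) (P-≥first : ∀ {n} → P n → first ≤ n) where

    -- Branching on `does` keeps proofs out of the evaluation of closed instances; `gap-correct`
    -- justifies the default 5.
    gap : ℕ → ℕ
    gap n = if does (P? (1 + n)) then 1 else
            if does (P? (2 + n)) then 2 else
            if does (P? (3 + n)) then 3 else 5

    gap-correct : ∀ n → P n → Gap P n (gap n)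
    gap-correct n p with P? (1 + n)
    ... | yes p₁ = gap₁ p₁
    ... | no ¬1 with P? (2 + n)
    ...   | yes p₂ = gap₂ ¬1 p₂
    ...   | no ¬2 with P? (3 + n)
    ...     | yes p₃ = gap₃ ¬1 ¬2 p₃
    ...     | no ¬3 = gap₅ ¬1 ¬2 ¬3 ¬4 p₅
      where
      ¬4 : ¬ P (4 + n)
      ¬4 p₄ with Steps.skip₄ (Steps-P n) p p₄
      ... | inj₁ p₂ = ¬2 p₂
      ... | inj₂ p₃ = ¬3 p₃
      p₅ : P (5 + n)
      p₅ with Steps.skip (Steps-P n) p
      ... | inj₁ p₂ = contradiction p₂ ¬2
      ... | inj₂ (inj₁ p₃) = contradiction p₃ ¬3
      ... | inj₂ (inj₂ q) = q

    succ : ℕ → ℕ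
    succ n = gap n + n

    enum : ℕ → ℕ
    enum zero = first
    enum (suc k) = succ (enum k)

    P-enum : ∀ k → P (enum k)
    P-enum zero = P-first
    P-enum (suc k) = Gap-target (gap-correct (enum k) (P-enum k))

    enum-gap : ∀ k → Gap P (enum k) (gap (enum k))
    enum-gap k = gap-correct (enum k) (P-enum k)

    enum-< : ∀ k → enum k < enum (suc k)
    enum-< k = m<n+m (enum k) (Gap-pos (enum-gap k))

    bracket : ∀ d → ∃ λ k → enum k ≤ first + d × first + d < enum (suc k)
    bracket zero = 0 , m≤m+n first 0 , subst (_< enum 1) (sym (+-identityʳ first)) (enum-< 0)
    bracket (suc d) with k , lo , hi ← bracket d with first + suc d <? enum (suc k)
    ... | yes h = k , ≤-trans lo (+-monoʳ-≤ first (n≤1+n d)) , h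
    ... | no h = suc k , ≮⇒≥ h , ≤-<-trans (subst (_≤ enum (suc k)) (sym (+-suc first d)) hi) (enum-< (suc k))

    enum-surjective : ∀ n → P n → ∃ λ k → enum k ≡ n
    enum-surjective n p with d , refl ← m≤n⇒∃[o]m+o≡n (P-≥first p) with k , lo , hi ← bracket d
      with i , eq ← m≤n⇒∃[o]m+o≡n lo = k , exact i eq
      where
      exact : ∀ i → enum k + i ≡ first + d → enum k ≡ first + d
      exact zero eq = trans (sym (+-identityʳ (enum k))) eq
      exact i@(suc _) eq = contradiction (subst P (trans (sym eq) (+-comm (enum k) i)) p)
        (Gap-empty (enum-gap k) i (s≤s z≤n)
          (+-cancelʳ-< (enum k) i (gap (enum k)) (subst (_< enum (suc k)) (trans (sym eq) (+-comm (enum k) i)) hi)))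

    isEnum : IsEnum P enum
    isEnum = enum-< , λ n → enum-surjective n , λ { (k , refl) → P-enum k }

    second-gap : ∀ k → enum (2 + k) ∸ enum k ≡ gap (enum (suc k)) + gap (enum k)
    second-gap k = trans (cong (_∸ enum k) (sym (+-assoc (gap (enum (suc k))) (gap (enum k)) (enum k))))
      (m+n∸n≡m (gap (enum (suc k)) + gap (enum k)) (enum k))

    gaps⊆target : ∀ m → (∃ λ k → enum (2 + k) ∸ enum k ≡ m) → m ∈ targetGaps
    gaps⊆target m (k , refl) = subst (_∈ targetGaps) (sym (second-gap k))
      (two-gaps (P-enum k) (Steps-P (enum k)) (enum-gap k) (enum-gap (suc k)))

    -- The index k comes from `enum-surjective` and need not be computed, as the difference depends
    -- on n alone.
    attained : ∀ n → {_ : True (P? n)} → ∃ λ k → enum (2 + k) ∸ enum k ≡ succ (succ n) ∸ n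
    attained n {p} with k , refl ← enum-surjective n (toWitness p) = k , refl

  InU⇒≥3 : ∀ {n} → InU n → 3 ≤ n
  InU⇒≥3 u@(2≤n , _) = ≤∧≢⇒< 2≤n λ { refl → toWitness {a? = ¬? (Class? true 2)} _ u }

  module D = Enumeration InD (Class? false) (Class-Steps false) 2 (toWitness {a? = Class? false 2} _) proj₁
  module U = Enumeration InU (Class? true) (Class-Steps true) 3 (toWitness {a? = Class? true 3} _) InU⇒≥3

  D-attained : All (λ m → ∃ λ k → D.enum (2 + k) ∸ D.enum k ≡ m) targetGaps
  -- One witness per target, in the order of `targetGaps`. The value 10 arises only as 5 + 5, whence
  -- the large 746 and, for U, 1917.
  D-attained = D.attained 46 ∷ D.attained 7 ∷ D.attained 5 ∷ D.attained 2 ∷ D.attained 96 ∷ D.attained 15 ∷ D.attained 746 ∷ []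

  U-attained : All (λ m → ∃ λ k → U.enum (2 + k) ∸ U.enum k ≡ m) targetGaps
  U-attained = U.attained 19 ∷ U.attained 3 ∷ U.attained 4 ∷ U.attained 6 ∷ U.attained 8 ∷ U.attained 42 ∷ U.attained 1917 ∷ []

open Gaps

theorem7 : (Σ (ℕ → ℕ) λ d → IsEnum InD d × GapSet d targetGaps)
    × (Σ (ℕ → ℕ) λ u → IsEnum InU u × GapSet u targetGaps)
theorem7 = (D.enum , D.isEnum , λ m → D.gaps⊆target m , All.lookup D-attained)
         , (U.enum , U.isEnum , λ m → U.gaps⊆target m , All.lookup U-attained)
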